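{- Let $A'$ be a $(0,\pm1)$-hypermatrix of size $m'\times n'\times k'$. Then there exist an integer $n\ge\max(m',n',k')$ and an $n\times n\times n$ alternating sign hypermatrix $A$ having $A'$ as a subhypermatrix (i.e. $A'$ is obtained from $A$ by deleting some planes). In fact, $A$ may be obtained from $A'$ by repeatedly inserting new planes (horizontal, column-vertical and row-vertical) each of which is a subpermutation matrix or the negative of a subpermutation matrix.
   Context: For a hypermatrix $[a_{ijk}]$, horizontal planes fix $k$, row-vertical planes fix $i$, column-vertical planes fix $j$; lines are obtained by fixing two of the three indices and varying the third. An $n\times n\times n$ $(0,\pm1)$-hypermatrix is an alternating sign hypermatrix (ASHM) if in every line the nonzero entries alternate in sign beginning and ending with $+1$. A subpermutation matrix is a $(0,1)$-matrix with at most one $1$ in each row and column. -}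

module Defs where

open import Data.Nat using (ℕ; suc)
open import Data.Fin using (Fin; _<_; punchOut)
open import Data.Fin.Properties using (_≟_)
open import Data.Integer as ℤ using (ℤ; 0ℤ; 1ℤ; -1ℤ; -_)
open import Data.List using (List; []; _∷_; filter; tabulate)
open import Data.Sum using (_⊎_)
open import Relation.Binary.PropositionalEquality using (_≡_; _≢_)
open import Relation.Nullary using (¬_; yes; no; ¬?)

Hyper : ℕ → ℕ → ℕ → Set
Hyper a b c = Fin a → Fin b → Fin c → ℤ

ZeroPM : ℤ → Set
ZeroPM x = x ≡ 0ℤ ⊎ x ≡ 1ℤ ⊎ x ≡ -1ℤ

IsZeroPMHyper : ∀ {a b c} → Hyper a b c → Set
IsZeroPMHyper A = ∀ i j k → ZeroPM (A i j k)

nonzeros : ∀ {n} → (Fin n → ℤ) → List ℤ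
nonzeros v = filter (λ x → ¬? (x ℤ.≟ 0ℤ)) (tabulate v)

data AltSeq : List ℤ → Set where
  single : AltSeq (1ℤ ∷ [])
  cons   : ∀ {l} → AltSeq l → AltSeq (1ℤ ∷ -1ℤ ∷ l)

AltLine : ∀ {n} → (Fin n → ℤ) → Set
AltLine v = AltSeq (nonzeros v)

IsASHM : (n : ℕ) → Hyper n n n → Set
IsASHM n A =
  IsZeroPMHyper A
  × (∀ j k → AltLine (λ i → A i j k))
  × (∀ i k → AltLine (λ j → A i j k))
  × (∀ i j → AltLine (λ k → A i j k))
  where open import Data.Product using (_×_)

StrictlyIncreasing : ∀ {m n} → (Fin m → Fin n) → Set
StrictlyIncreasing f = ∀ x y → x < y → f x < f y

open import Data.Product using (Σ; _×_; ∃-syntax)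

SubHyper : ∀ {a b c a' b' c'} → Hyper a' b' c' → Hyper a b c → Set
SubHyper {a} {b} {c} {a'} {b'} {c'} A' A =
  Σ (Fin a' → Fin a) λ f → Σ (Fin b' → Fin b) λ g → Σ (Fin c' → Fin c) λ h →
    StrictlyIncreasing f × StrictlyIncreasing g × StrictlyIncreasing h
    × (∀ i j k → A' i j k ≡ A (f i) (g j) (h k))

IsSubPerm : ∀ {r s} → (Fin r → Fin s → ℤ) → Set
IsSubPerm P =
  (∀ x y → P x y ≡ 0ℤ ⊎ P x y ≡ 1ℤ)
  × (∀ x y y' → P x y ≡ 1ℤ → P x y' ≡ 1ℤ → y ≡ y')
  × (∀ x x' y → P x y ≡ 1ℤ → P x' y ≡ 1ℤ → x ≡ x')

IsSignedSubPerm : ∀ {r s} → (Fin r → Fin s → ℤ) → Set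
IsSignedSubPerm {r} {s} P =
  Σ (Fin r → Fin s → ℤ) λ Q → IsSubPerm Q × ((∀ x y → P x y ≡ Q x y) ⊎ (∀ x y → P x y ≡ - Q x y))

ins : ∀ {a} {X : Set} → Fin (suc a) → X → (Fin a → X) → Fin (suc a) → X
ins p x f i with p ≟ i
... | yes _ = x
... | no ne = f (punchOut ne)

record HM : Set where
  constructor mkHM
  field
    d₁ d₂ d₃ : ℕ
    ent : Hyper d₁ d₂ d₃

data Step : HM → HM → Set where
  rowVert : ∀ {a b c} (A : Hyper a b c) (p : Fin (suc a)) (P : Fin b → Fin c → ℤ) →
    IsSignedSubPerm P → Step (mkHM a b c A) (mkHM (suc a) b c (ins p P A))
  colVert : ∀ {a b c} (A : Hyper a b c) (p : Fin (suc b)) (P : Fin a → Fin c → ℤ) →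
    IsSignedSubPerm P → Step (mkHM a b c A) (mkHM a (suc b) c (λ i → ins p (P i) (A i)))
  horiz : ∀ {a b c} (A : Hyper a b c) (p : Fin (suc c)) (P : Fin a → Fin b → ℤ) →
    IsSignedSubPerm P → Step (mkHM a b c A) (mkHM a b (suc c) (λ i j → ins p (P i j) (A i j)))

{-# OPTIONS --safe #-}
module Submission where

open import Defs
open import Data.Nat using (ℕ; _≤_; _⊔_)
open import Data.Product using (Σ; _×_; ∃-syntax)
open import Relation.Binary.Construct.Closure.ReflexiveTransitive using (Star)

open import Data.Bool using (Bool; true; false; if_then_else_)
open import Data.Fin as Fin using (Fin; zero; suc; punchIn; punchOut)
open import Data.Fin.Permutation.Components using (transpose; transpose-inverse)
open import Data.Fin.Properties as Fin using (_≟_)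
open import Data.Integer as ℤ using (ℤ; 0ℤ; 1ℤ; -1ℤ; +_)
open import Data.Integer.Properties as ℤ using ()
open import Data.List using (List; []; _∷_; [_]; _++_; allFin; cartesianProduct; filter; foldr; length; lookup; null)
open import Data.List.Membership.Propositional using (_∈_)
open import Data.List.Membership.Propositional.Properties using (∈-allFin; ∈-cartesianProduct⁺; ∈-lookup)
open import Data.List.Properties using (filter-accept; filter-reject; tabulate-cong; ++-assoc; ∷-injective)
open import Data.List.Relation.Unary.All as All using (All; []; _∷_)
open import Data.List.Relation.Unary.AllPairs using ([]; _∷_)
open import Data.List.Relation.Unary.Any using (here; there; any?)
open import Data.List.Relation.Unary.Unique.Propositional using (Unique)
open import Data.Maybe as Maybe using (Maybe; just; nothing)
open import Data.Maybe.Properties as Maybe using (just-injective)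
open import Data.Nat using (zero; suc; _+_)
open import Data.Nat.Properties as ℕ using ()
open import Data.Nat.Solver using (module +-*-Solver)
open import Data.Product using (_,_; proj₁; proj₂)
open import Data.Product.Properties using (≡-dec)
open import Data.Sum using (_⊎_; inj₁; inj₂)
open import Data.Unit using (⊤)
open import Function using (_∘_)
open import Function.Definitions using (Injective)
open import Relation.Binary using (tri<; tri≈; tri>)
open import Relation.Binary.Construct.Closure.ReflexiveTransitive using (ε; _◅_; _◅◅_)
open import Relation.Binary.PropositionalEquality using (_≡_; _≢_; refl; sym; trans; cong; cong₂; subst; module ≡-Reasoning)
open import Relation.Nullary using (¬_; Dec; yes; no; ¬?; contradiction; _×-dec_)
open import Algebra.Properties.CommutativeMonoid.Sum ℤ.+-0-commutativeMonoid using (sum; sum-cong-≗; sum-syntax; ∑-comm; ∑-distrib-+)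

-- Inserting planes with a single nonzero entry lets one repair each line separately, at the price of new
-- lines that are empty or have that one nonzero entry.  First insert entries -1 until no line has two
-- consecutive +1's.  From then on entries +1 suffice: repairing the three directions in turn makes every
-- line alternating or empty, with no empty line in the last direction repaired.  What remains resembles a
-- Latin rectangle, an a × b array whose cells hold one (signed) symbol in total, each symbol occurring at
-- most once in total in each row and column.  As in Ryser's theorem, once there are at least a + b symbols
-- it extends to a Latin square: the empty lines of one direction form a bipartite graph, and the classes
-- of a König edge colouring of that graph are the (sub)permutation planes to insert.

-- Reachability by insertions

-- Parametricity of `ins`: taking `_~_` to be the passage to a line, or a predicate on lines,
-- transfers facts about planes to the enlarged hypermatrix.
ins-rel : ∀ {a} {X Y : Set} (_~_ : X → Y → Set) (p : Fin (suc a)) x y (f : Fin a → X) (g : Fin a → Y) →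
  x ~ y → (∀ i → f i ~ g i) → ∀ i → ins p x f i ~ ins p y g i
ins-rel _~_ p x y f g x~y f~g i with p ≟ i
... | yes _ = x~y
... | no _  = f~g _

ins-punchIn : ∀ {a} {X : Set} (p : Fin (suc a)) (x : X) (f : Fin a → X) i → ins p x f (punchIn p i) ≡ f i
ins-punchIn p x f i with p ≟ punchIn p i
... | yes eq = contradiction (sym eq) (Fin.punchInᵢ≢i p i)
... | no ne  = cong f (trans (Fin.punchOut-cong p refl) (Fin.punchOut-punchIn p))

_≋_ : ∀ {a b c} → Hyper a b c → Hyper a b c → Set
A ≋ B = ∀ i j k → A i j k ≡ B i j k

-- Steps produce specific functions and function extensionality is unavailable, so targets are taken up to pointwise equality.
_⟶_ : ∀ {a b c a′ b′ c′} → Hyper a b c → Hyper a′ b′ c′ → Set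
_⟶_ {a} {b} {c} {a′} {b′} {c′} A B =
  Σ (Hyper a′ b′ c′) λ B′ → B′ ≋ B × Star Step (mkHM a b c A) (mkHM a′ b′ c′ B′)

-- The same plane is inserted at the same place, so steps can be replayed on a pointwise equal
-- source.
Step-resp-≋ : ∀ {a b c} {A A′ : Hyper a b c} {H} → A′ ≋ A → Step (mkHM a b c A) H →
  Σ (Hyper (HM.d₁ H) (HM.d₂ H) (HM.d₃ H)) λ B′ → B′ ≋ HM.ent H × Step (mkHM a b c A′) (mkHM _ _ _ B′)
Step-resp-≋ {A′ = A′} e (rowVert A p P s) =
  _ , (λ i j k → ins-rel (λ X Y → X j k ≡ Y j k) p P P A′ A refl (λ i′ → e i′ j k) i) , rowVert A′ p P s
Step-resp-≋ {A′ = A′} e (colVert A p P s) =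
  _ , (λ i j k → ins-rel (λ X Y → X k ≡ Y k) p (P i) (P i) (A′ i) (A i) refl (λ j′ → e i j′ k) j) , colVert A′ p P s
Step-resp-≋ {A′ = A′} e (horiz A p P s) =
  _ , (λ i j k → ins-rel _≡_ p (P i j) (P i j) (A′ i j) (A i j) refl (e i j) k) , horiz A′ p P s

Star-resp-≋ : ∀ {a b c} {A A′ : Hyper a b c} {H} → A′ ≋ A → Star Step (mkHM a b c A) H → A′ ⟶ HM.ent H
Star-resp-≋ {A′ = A′} e ε = A′ , e , ε
Star-resp-≋ e (s ◅ ss) with Step-resp-≋ e s
... | B′ , e′ , s′ with Star-resp-≋ e′ ss
... | C′ , e″ , ss′ = C′ , e″ , s′ ◅ ss′

⟶-reflexive : ∀ {a b c} {A B : Hyper a b c} → A ≋ B → A ⟶ B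
⟶-reflexive e = _ , e , ε

⟶-trans : ∀ {a b c a′ b′ c′ a″ b″ c″} {A : Hyper a b c} {B : Hyper a′ b′ c′} {C : Hyper a″ b″ c″} →
  A ⟶ B → B ⟶ C → A ⟶ C
⟶-trans (B′ , e , ss) (C′ , e′ , ss′) with Star-resp-≋ e ss′
... | C″ , e″ , ss″ = C″ , (λ i j k → trans (e″ i j k) (e′ i j k)) , ss ◅◅ ss″

⟶-ins : ∀ {a b c} (A : Hyper a b c) p P → IsSignedSubPerm P → A ⟶ ins p P A
⟶-ins A p P s = _ , (λ _ _ _ → refl) , rowVert A p P s ◅ ε

-- Rotating the indices reduces all three directions to insertions of row-vertical planes.
cyc : ∀ {a b c} → Hyper a b c → Hyper b c a
cyc A j k i = A i j k

IsSubPerm-transpose : ∀ {r s} {P : Fin r → Fin s → ℤ} → IsSubPerm P → IsSubPerm (λ y x → P x y)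
IsSubPerm-transpose (zo , row , col) = (λ y x → zo x y) , (λ y x x′ → col x x′ y) , (λ y y′ x → row x y y′)

IsSignedSubPerm-transpose : ∀ {r s} {P : Fin r → Fin s → ℤ} → IsSignedSubPerm P → IsSignedSubPerm (λ y x → P x y)
IsSignedSubPerm-transpose (Q , q , inj₁ e) = _ , IsSubPerm-transpose q , inj₁ (λ y x → e x y)
IsSignedSubPerm-transpose (Q , q , inj₂ e) = _ , IsSubPerm-transpose q , inj₂ (λ y x → e x y)

-- Rotation permutes the three kinds of plane. Two of the kinds arrive transposed, and transposing
-- preserves signed subpermutations.
Step-cyc : ∀ {a b c} {A : Hyper a b c} {H} → Step (mkHM a b c A) H → cyc A ⟶ cyc (HM.ent H)
Step-cyc (rowVert A p P s) =
  _ , (λ j k i → sym (ins-rel (λ X y → X j k ≡ y) p P (P j k) A (cyc A j k) refl (λ _ → refl) i)) , horiz (cyc A) p P s ◅ ε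
Step-cyc (colVert A p P s) =
  _ , (λ j k i → ins-rel (λ X Y → X k i ≡ Y k) p (λ k i → P i k) (P i) (cyc A) (A i) refl (λ _ → refl) j) ,
  rowVert (cyc A) p (λ k i → P i k) (IsSignedSubPerm-transpose s) ◅ ε
Step-cyc (horiz A p P s) =
  _ , (λ j k i → ins-rel (λ X y → X i ≡ y) p (λ i → P i j) (P i j) (cyc A j) (A i j) refl (λ _ → refl) k) ,
  colVert (cyc A) p (λ j i → P i j) (IsSignedSubPerm-transpose s) ◅ ε

Star-cyc : ∀ {a b c} {A : Hyper a b c} {H} → Star Step (mkHM a b c A) H → cyc A ⟶ cyc (HM.ent H)
Star-cyc ε = ⟶-reflexive (λ _ _ _ → refl)
Star-cyc (s ◅ ss) = ⟶-trans (Step-cyc s) (Star-cyc ss)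

⟶-cyc : ∀ {a b c a′ b′ c′} {A : Hyper a b c} {B : Hyper a′ b′ c′} → A ⟶ B → cyc A ⟶ cyc B
⟶-cyc (B′ , e , ss) = ⟶-trans (Star-cyc ss) (⟶-reflexive (λ j k i → e i j k))

-- Insertions and subhypermatrices

punchIn-mono-< : ∀ {n} (p : Fin (suc n)) → StrictlyIncreasing (punchIn p)
punchIn-mono-< p x y x<y = ℕ.≰⇒> (λ le → ℕ.<⇒≱ x<y (Fin.punchIn-cancel-≤ p y x le))

SubHyper-refl : ∀ {a b c} {A : Hyper a b c} → SubHyper A A
SubHyper-refl = (λ i → i) , (λ j → j) , (λ k → k) ,
  (λ _ _ lt → lt) , (λ _ _ lt → lt) , (λ _ _ lt → lt) , (λ _ _ _ → refl)

SubHyper-trans : ∀ {a b c a′ b′ c′ a″ b″ c″} {A : Hyper a b c} {B : Hyper a′ b′ c′} {C : Hyper a″ b″ c″} →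
  SubHyper A B → SubHyper B C → SubHyper A C
SubHyper-trans (f , g , h , f↑ , g↑ , h↑ , e) (f′ , g′ , h′ , f′↑ , g′↑ , h′↑ , e′) =
  f′ ∘ f , g′ ∘ g , h′ ∘ h ,
  (λ x y lt → f′↑ _ _ (f↑ x y lt)) , (λ x y lt → g′↑ _ _ (g↑ x y lt)) , (λ x y lt → h′↑ _ _ (h↑ x y lt)) ,
  (λ i j k → trans (e i j k) (e′ (f i) (g j) (h k)))

Step⇒SubHyper : ∀ {H K} → Step H K → SubHyper (HM.ent H) (HM.ent K)
Step⇒SubHyper (rowVert A p P _) = punchIn p , (λ j → j) , (λ k → k) ,
  punchIn-mono-< p , (λ _ _ lt → lt) , (λ _ _ lt → lt) ,
  (λ i j k → sym (cong (λ X → X j k) (ins-punchIn p P A i)))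
Step⇒SubHyper (colVert A p P _) = (λ i → i) , punchIn p , (λ k → k) ,
  (λ _ _ lt → lt) , punchIn-mono-< p , (λ _ _ lt → lt) ,
  (λ i j k → sym (cong (λ X → X k) (ins-punchIn p (P i) (A i) j)))
Step⇒SubHyper (horiz A p P _) = (λ i → i) , (λ j → j) , punchIn p ,
  (λ _ _ lt → lt) , (λ _ _ lt → lt) , punchIn-mono-< p ,
  (λ i j k → sym (ins-punchIn p (P i j) (A i j) k))

Star⇒SubHyper : ∀ {H K} → Star Step H K → SubHyper (HM.ent H) (HM.ent K)
Star⇒SubHyper ε = SubHyper-refl
Star⇒SubHyper {K = K} (s ◅ ss) = SubHyper-trans {C = HM.ent K} (Step⇒SubHyper s) (Star⇒SubHyper ss)

StrictlyIncreasing⇒≤ : ∀ {m n} {f : Fin m → Fin n} → StrictlyIncreasing f → m ≤ n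
StrictlyIncreasing⇒≤ {f = f} f↑ = Fin.injective⇒≤ λ {x} {y} → inj x y
  where
  inj : ∀ x y → f x ≡ f y → x ≡ y
  inj x y eq with Fin.<-cmp x y
  ... | tri< lt _ _ = contradiction eq (Fin.<⇒≢ (f↑ x y lt))
  ... | tri≈ _ e _  = e
  ... | tri> _ _ gt = contradiction (sym eq) (Fin.<⇒≢ (f↑ y x gt))

-- Repairing lines

nonzeros-cong : ∀ {n} {v w : Fin n → ℤ} → (∀ i → v i ≡ w i) → nonzeros v ≡ nonzeros w
nonzeros-cong e = cong (filter _) (tabulate-cong e)

nonzeros-reject : ∀ {n} (v : Fin (suc n) → ℤ) → v zero ≡ 0ℤ → nonzeros v ≡ nonzeros (v ∘ suc)
nonzeros-reject v z = filter-reject (λ x → ¬? (x ℤ.≟ 0ℤ)) (λ nz → nz z)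

nonzeros-accept : ∀ {n} (v : Fin (suc n) → ℤ) → v zero ≢ 0ℤ → nonzeros v ≡ v zero ∷ nonzeros (v ∘ suc)
nonzeros-accept v = filter-accept (λ x → ¬? (x ℤ.≟ 0ℤ))

nonzeros-empty : ∀ {n} (v : Fin n → ℤ) → (∀ i → v i ≡ 0ℤ) → nonzeros v ≡ []
nonzeros-empty {zero}  v z = refl
nonzeros-empty {suc n} v z = trans (nonzeros-reject v (z zero)) (nonzeros-empty (v ∘ suc) (z ∘ suc))

nonzeros-single : ∀ {n} (v : Fin n → ℤ) i → v i ≢ 0ℤ → (∀ j → j ≢ i → v j ≡ 0ℤ) → nonzeros v ≡ [ v i ]
nonzeros-single v zero nz z =
  trans (nonzeros-accept v nz) (cong (v zero ∷_) (nonzeros-empty (v ∘ suc) (λ j → z (suc j) (λ ()))))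
nonzeros-single v (suc i) nz z =
  trans (nonzeros-reject v (z zero (λ ())))
        (nonzeros-single (v ∘ suc) i nz (λ j j≢i → z (suc j) (j≢i ∘ Fin.suc-injective)))

nonzeros-exactlyOne : ∀ {n x} (v : Fin n → ℤ) → x ≢ 0ℤ → (∀ i → v i ≡ 0ℤ ⊎ v i ≡ x) →
  (∀ i j → v i ≡ x → v j ≡ x → i ≡ j) → ∃[ i ] v i ≡ x → nonzeros v ≡ [ x ]
nonzeros-exactlyOne v x≢0 zx uniq (i , vi≡x) =
  trans (nonzeros-single v i (x≢0 ∘ trans (sym vi≡x)) z) (cong [_] vi≡x)
  where
  z : ∀ j → j ≢ i → v j ≡ 0ℤ
  z j j≢i with zx j
  ... | inj₁ e = e
  ... | inj₂ e = contradiction (uniq j i e vi≡x) j≢i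

nonzeros-atMostOne : ∀ {n x} (v : Fin n → ℤ) → x ≢ 0ℤ → (∀ i → v i ≡ 0ℤ ⊎ v i ≡ x) →
  (∀ i j → v i ≡ x → v j ≡ x → i ≡ j) → nonzeros v ≡ [] ⊎ nonzeros v ≡ [ x ]
nonzeros-atMostOne {x = x} v x≢0 zx uniq with Fin.any? (λ i → v i ℤ.≟ x)
... | yes one = inj₂ (nonzeros-exactlyOne v x≢0 zx uniq one)
... | no none = inj₁ (nonzeros-empty v z)
  where
  z : ∀ i → v i ≡ 0ℤ
  z i with zx i
  ... | inj₁ e = e
  ... | inj₂ e = contradiction (i , e) none

All-nonzeros⁺ : ∀ {n} {Q : ℤ → Set} (v : Fin n → ℤ) → (∀ i → v i ≢ 0ℤ → Q (v i)) → All Q (nonzeros v)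
All-nonzeros⁺ {zero}  v q = []
All-nonzeros⁺ {suc n} v q with v zero ℤ.≟ 0ℤ
... | yes z = All-nonzeros⁺ (v ∘ suc) (q ∘ suc)
... | no nz = q zero nz ∷ All-nonzeros⁺ (v ∘ suc) (q ∘ suc)

All-nonzeros⁻ : ∀ {n} {Q : ℤ → Set} (v : Fin n → ℤ) → All Q (nonzeros v) → ∀ i → v i ≢ 0ℤ → Q (v i)
All-nonzeros⁻ {suc n} v qs i vi≢0 with v zero ℤ.≟ 0ℤ
All-nonzeros⁻ v qs       zero    vi≢0 | yes z = contradiction z vi≢0
All-nonzeros⁻ v qs       (suc i) vi≢0 | yes z = All-nonzeros⁻ (v ∘ suc) qs i vi≢0
All-nonzeros⁻ v (q ∷ qs) zero    vi≢0 | no _  = q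
All-nonzeros⁻ v (q ∷ qs) (suc i) vi≢0 | no _  = All-nonzeros⁻ (v ∘ suc) qs i vi≢0

ins-suc-suc : ∀ {a} {X : Set} (p : Fin (suc a)) x (v : Fin (suc a) → X) i →
  ins (suc p) x v (suc i) ≡ ins p x (v ∘ suc) i
ins-suc-suc p x v i with p ≟ i
... | yes _ = refl
... | no ne = cong (v ∘ suc) (Fin.punchOut-cong p refl)

nonzeros-ins-suc : ∀ {a} (p : Fin (suc a)) x (v : Fin (suc a) → ℤ) →
  nonzeros (ins (suc p) x v ∘ suc) ≡ nonzeros (ins p x (v ∘ suc))
nonzeros-ins-suc p x v = nonzeros-cong (ins-suc-suc p x v)

nonzeros-ins-0 : ∀ {a} (p : Fin (suc a)) (v : Fin a → ℤ) → nonzeros (ins p 0ℤ v) ≡ nonzeros v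
nonzeros-ins-0 zero v = nonzeros-reject (ins zero 0ℤ v) refl
nonzeros-ins-0 {suc a} (suc p) v with v zero ℤ.≟ 0ℤ
... | yes z = trans (nonzeros-ins-suc p 0ℤ v) (nonzeros-ins-0 p (v ∘ suc))
... | no nz = cong (v zero ∷_) (trans (nonzeros-ins-suc p 0ℤ v) (nonzeros-ins-0 p (v ∘ suc)))

-- Walking past the zeros of `v` and the entries of `l₁` finds a position. Repairs can therefore be
-- planned on lists of nonzero entries.
nonzeros-ins-split : ∀ {a x} (v : Fin a → ℤ) (l₁ l₂ : List ℤ) → x ≢ 0ℤ → nonzeros v ≡ l₁ ++ l₂ →
  ∃[ p ] nonzeros (ins p x v) ≡ l₁ ++ x ∷ l₂
nonzeros-ins-split {x = x} v [] l₂ x≢0 e = zero , trans (nonzeros-accept (ins zero x v) x≢0) (cong (x ∷_) e)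
nonzeros-ins-split {zero} v (y ∷ l₁) l₂ x≢0 ()
nonzeros-ins-split {suc a} {x} v (y ∷ l₁) l₂ x≢0 e with v zero ℤ.≟ 0ℤ
... | yes z with nonzeros-ins-split (v ∘ suc) (y ∷ l₁) l₂ x≢0 e
...   | p , e′ = suc p , trans (nonzeros-reject (ins (suc p) x v) z) (trans (nonzeros-ins-suc p x v) e′)
nonzeros-ins-split {suc a} {x} v (y ∷ l₁) l₂ x≢0 e | no nz
  with ∷-injective e
... | refl , e₂ with nonzeros-ins-split (v ∘ suc) l₁ l₂ x≢0 e₂
...   | p , e′ = suc p , trans (nonzeros-accept (ins (suc p) x v) nz) (cong (v zero ∷_) (trans (nonzeros-ins-suc p x v) e′))

-- The second family is indexed (k , i), so that cyc merely rotates the three predicates.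
record Lines {a b c} (F G H : List ℤ → Set) (A : Hyper a b c) : Set where
  constructor lines
  field
    lines₁ : ∀ j k → F (nonzeros (λ i → A i j k))
    lines₂ : ∀ k i → G (nonzeros (λ j → A i j k))
    lines₃ : ∀ i j → H (nonzeros (λ k → A i j k))

Lines-cyc : ∀ {a b c F G H} {A : Hyper a b c} → Lines F G H A → Lines G H F (cyc A)
Lines-cyc (lines f g h) = lines g h f

-- The matrix unit at `(j₀ , k₀)`, scaled by `x`: the plane inserted by every repair.
unit : ∀ {b c} → ℤ → Fin b → Fin c → Fin b → Fin c → ℤ
unit x j₀ k₀ j k with j ≟ j₀ | k ≟ k₀
... | yes _ | yes _ = x
... | yes _ | no _  = 0ℤ
... | no _  | _     = 0ℤ

unit-here : ∀ {b c} x (j₀ : Fin b) (k₀ : Fin c) → unit x j₀ k₀ j₀ k₀ ≡ x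
unit-here x j₀ k₀ with j₀ ≟ j₀ | k₀ ≟ k₀
... | yes _ | yes _ = refl
... | yes _ | no ne = contradiction refl ne
... | no ne | _     = contradiction refl ne

unit-elsewhere : ∀ {b c} x (j₀ j : Fin b) (k₀ k : Fin c) → (j , k) ≢ (j₀ , k₀) → unit x j₀ k₀ j k ≡ 0ℤ
unit-elsewhere x j₀ j k₀ k ne with j ≟ j₀ | k ≟ k₀
... | yes refl | yes refl = contradiction refl ne
... | yes _    | no _     = refl
... | no _     | _        = refl

unit-values : ∀ {b c} x (j₀ : Fin b) (k₀ : Fin c) j k → unit x j₀ k₀ j k ≡ 0ℤ ⊎ unit x j₀ k₀ j k ≡ x
unit-values x j₀ k₀ j k with j ≟ j₀ | k ≟ k₀
... | yes _ | yes _ = inj₂ refl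
... | yes _ | no _  = inj₁ refl
... | no _  | _     = inj₁ refl

unit≡x⇒here : ∀ {b c x} → x ≢ 0ℤ → (j₀ : Fin b) (k₀ : Fin c) → ∀ {j k} → unit x j₀ k₀ j k ≡ x → j ≡ j₀ × k ≡ k₀
unit≡x⇒here x≢0 j₀ k₀ {j} {k} e with j ≟ j₀ | k ≟ k₀
... | yes p | yes q = p , q
... | yes _ | no _  = contradiction (sym e) x≢0
... | no _  | _     = contradiction (sym e) x≢0

unit-IsSubPerm : ∀ {b c} (j₀ : Fin b) (k₀ : Fin c) → IsSubPerm (unit 1ℤ j₀ k₀)
unit-IsSubPerm j₀ k₀ = unit-values 1ℤ j₀ k₀ ,
  (λ _ _ _ e e′ → trans (proj₂ (here′ e)) (sym (proj₂ (here′ e′)))) ,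
  (λ _ _ _ e e′ → trans (proj₁ (here′ e)) (sym (proj₁ (here′ e′))))
  where
  here′ : ∀ {j k} → unit 1ℤ j₀ k₀ j k ≡ 1ℤ → j ≡ j₀ × k ≡ k₀
  here′ = unit≡x⇒here (λ ()) j₀ k₀

data IsSign : ℤ → Set where
  plus  : IsSign 1ℤ
  minus : IsSign -1ℤ

IsSign⇒≢0 : ∀ {x} → IsSign x → x ≢ 0ℤ
IsSign⇒≢0 plus ()
IsSign⇒≢0 minus ()

unit-IsSignedSubPerm : ∀ {b c x} (j₀ : Fin b) (k₀ : Fin c) → IsSign x → IsSignedSubPerm (unit x j₀ k₀)
unit-IsSignedSubPerm j₀ k₀ plus = _ , unit-IsSubPerm j₀ k₀ , inj₁ (λ _ _ → refl)
unit-IsSignedSubPerm j₀ k₀ minus = _ , unit-IsSubPerm j₀ k₀ , inj₂ neg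
  where
  neg : ∀ x y → unit -1ℤ j₀ k₀ x y ≡ ℤ.- unit 1ℤ j₀ k₀ x y
  neg x y with x ≟ j₀ | y ≟ k₀
  ... | yes _ | yes _ = refl
  ... | yes _ | no _  = refl
  ... | no _  | _     = refl

data Insertions (x : ℤ) : List ℤ → List ℤ → Set where
  done : Insertions x [] []
  keep : ∀ {y l l′} → Insertions x l l′ → Insertions x (y ∷ l) (y ∷ l′)
  add  : ∀ {l l′} → Insertions x l l′ → Insertions x l (x ∷ l′)

-- `Q₂` and `Q₃` are invariants of the two other directions. A unit plane leaves the old lines there
-- intact and adds lines that are `[]` or `[ x ]`, which is why exactly these lists are assumed to
-- be good.
module Repair {b c : ℕ} {x : ℤ} (x± : IsSign x) (Q₂ Q₃ : List ℤ → Set)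
  (Q₂[] : Q₂ []) (Q₂[x] : Q₂ [ x ]) (Q₃[] : Q₃ []) (Q₃[x] : Q₃ [ x ]) where

  private
    Any-list : List ℤ → Set
    Any-list _ = ⊤

    x≢0 = IsSign⇒≢0 x±

  record LineRepaired {a} (A : Hyper a b c) (j₀ : Fin b) (k₀ : Fin c) (l : List ℤ) : Set where
    constructor repaired
    field
      {a′}    : ℕ
      B       : Hyper a′ b c
      reached : A ⟶ B
      target  : nonzeros (λ i → B i j₀ k₀) ≡ l
      others  : ∀ j k → (j , k) ≢ (j₀ , k₀) → nonzeros (λ i → B i j k) ≡ nonzeros (λ i → A i j k)
      across  : Lines Any-list Q₂ Q₃ B

  insertUnit : ∀ {a} (A : Hyper a b c) j₀ k₀ l₁ l₂ → nonzeros (λ i → A i j₀ k₀) ≡ l₁ ++ l₂ →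
    Lines Any-list Q₂ Q₃ A → LineRepaired A j₀ k₀ (l₁ ++ x ∷ l₂)
  insertUnit A j₀ k₀ l₁ l₂ e (lines _ g h) with nonzeros-ins-split (λ i → A i j₀ k₀) l₁ l₂ x≢0 e
  ... | p , e′ = repaired (ins p E A) (⟶-ins A p E (unit-IsSignedSubPerm j₀ k₀ x±))
      (trans (line j₀ k₀ (unit-here x j₀ k₀)) e′)
      -- Every other line in the first direction receives a zero, which `nonzeros` drops.
      (λ j k ne → trans (line j k (unit-elsewhere x j₀ j k₀ k ne)) (nonzeros-ins-0 p (λ i → A i j k)))
      (lines _
        (λ k → ins-rel (λ X Y → Q₂ (nonzeros (λ j → X j k))) p E E A A
                 (across Q₂ Q₂[] Q₂[x] (λ j → E j k) (λ j → unit-values x j₀ k₀ j k)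
                    (λ j j′ u u′ → trans (proj₁ (here! u)) (sym (proj₁ (here! u′))))) (g k))
        (λ i j → ins-rel (λ X Y → Q₃ (nonzeros (λ k → X j k))) p E E A A
                 (across Q₃ Q₃[] Q₃[x] (E j) (unit-values x j₀ k₀ j)
                    (λ k k′ u u′ → trans (proj₂ (here! u)) (sym (proj₂ (here! u′))))) (λ i → h i j) i))
    where
    E = unit x j₀ k₀
    here! : ∀ {j k} → E j k ≡ x → j ≡ j₀ × k ≡ k₀
    here! = unit≡x⇒here x≢0 j₀ k₀
    line : ∀ j k {y} → E j k ≡ y → nonzeros (λ i → ins p E A i j k) ≡ nonzeros (ins p y (λ i → A i j k))
    line j k {y} e″ = nonzeros-cong (ins-rel (λ X z → X j k ≡ z) p E y A (λ i → A i j k) e″ (λ _ → refl))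
    across : ∀ {n} (Q : List ℤ → Set) → Q [] → Q [ x ] → (v : Fin n → ℤ) → (∀ i → v i ≡ 0ℤ ⊎ v i ≡ x) →
      (∀ i j → v i ≡ x → v j ≡ x → i ≡ j) → Q (nonzeros v)
    across Q q[] q[x] v zx uniq with nonzeros-atMostOne v x≢0 zx uniq
    ... | inj₁ e₀ = subst Q (sym e₀) q[]
    ... | inj₂ e₁ = subst Q (sym e₁) q[x]

  LineRepaired-trans : ∀ {a j₀ k₀ l l′} {A : Hyper a b c} (r : LineRepaired A j₀ k₀ l) →
    LineRepaired (LineRepaired.B r) j₀ k₀ l′ → LineRepaired A j₀ k₀ l′
  LineRepaired-trans (repaired B r t o s) (repaired B′ r′ t′ o′ s′) =
    repaired B′ (⟶-trans r r′) t′ (λ j k ne → trans (o′ j k ne) (o j k ne)) s′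

  -- `l₀` is the prefix already in final form: `keep` moves one entry into it, and `add` inserts a
  -- unit plane just after it.
  repairLine : ∀ {a} (A : Hyper a b c) j₀ k₀ l₀ {l l′} → nonzeros (λ i → A i j₀ k₀) ≡ l₀ ++ l → Insertions x l l′ →
    Lines Any-list Q₂ Q₃ A → LineRepaired A j₀ k₀ (l₀ ++ l′)
  repairLine A j₀ k₀ l₀ e done s = repaired A (⟶-reflexive (λ _ _ _ → refl)) e (λ _ _ _ → refl) s
  repairLine A j₀ k₀ l₀ {y ∷ l} {y ∷ l′} e (keep ch) s =
    subst (LineRepaired A j₀ k₀) (++-assoc l₀ [ y ] l′)
      (repairLine A j₀ k₀ (l₀ ++ [ y ]) (trans e (sym (++-assoc l₀ [ y ] l))) ch s)
  repairLine A j₀ k₀ l₀ {l} {x ∷ l′} e (add ch) s =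
    let r = insertUnit A j₀ k₀ l₀ l e s in
    subst (LineRepaired A j₀ k₀) (++-assoc l₀ [ x ] l′)
      (LineRepaired-trans r (repairLine (LineRepaired.B r) j₀ k₀ (l₀ ++ [ x ])
        (trans (LineRepaired.target r) (sym (++-assoc l₀ [ x ] l))) ch (LineRepaired.across r)))

  module _ (Pre Post : List ℤ → Set) (Post⊆Pre : ∀ {l} → Post l → Pre l)
    (fix : ∀ {l} → Pre l → ∃[ l′ ] Insertions x l l′ × Post l′) where

    repairLines : ∀ {a} (A : Hyper a b c) (todo : List (Fin b × Fin c)) → Lines Pre Q₂ Q₃ A →
      (∀ j k → (j , k) ∈ todo ⊎ Post (nonzeros (λ i → A i j k))) →
      ∃[ a′ ] Σ (Hyper a′ b c) λ B → A ⟶ B × Lines Post Q₂ Q₃ B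
    repairLines A [] (lines f g h) d = _ , A , ⟶-reflexive (λ _ _ _ → refl) , lines d′ g h
      where
      d′ : ∀ j k → Post (nonzeros (λ i → A i j k))
      d′ j k with d j k
      ... | inj₂ q = q
    repairLines A ((j₀ , k₀) ∷ todo) (lines f g h) d with fix (f j₀ k₀)
    ... | l′ , ch , post with repairLine A j₀ k₀ [] refl ch (lines _ g h)
    ... | repaired B r t o (lines _ g′ h′) with repairLines B todo (lines f′ g′ h′) d′
      where
      post₀ : Post (nonzeros (λ i → B i j₀ k₀))
      post₀ = subst Post (sym t) post
      f′ : ∀ j k → Pre (nonzeros (λ i → B i j k))
      f′ j k with ≡-dec _≟_ _≟_ (j , k) (j₀ , k₀)
      ... | yes refl = Post⊆Pre post₀
      ... | no ne    = subst Pre (sym (o j k ne)) (f j k)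
      d′ : ∀ j k → (j , k) ∈ todo ⊎ Post (nonzeros (λ i → B i j k))
      d′ j k with ≡-dec _≟_ _≟_ (j , k) (j₀ , k₀) | d j k
      ... | yes refl | _                  = inj₂ post₀
      ... | no ne    | inj₁ (here eq)     = contradiction eq ne
      ... | no ne    | inj₁ (there jk∈)   = inj₁ jk∈
      ... | no ne    | inj₂ q             = inj₂ (subst Post (sym (o j k ne)) q)
    ... | _ , C , r′ , s = _ , C , ⟶-trans r r′ , s

    repair : ∀ {a} (A : Hyper a b c) → Lines Pre Q₂ Q₃ A →
      ∃[ a′ ] Σ (Hyper a′ b c) λ B → A ⟶ B × Lines Post Q₂ Q₃ B
    repair A s = repairLines A (cartesianProduct (allFin b) (allFin c)) s
      (λ j k → inj₁ (∈-cartesianProduct⁺ (∈-allFin j) (∈-allFin k)))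

-- Separating and then alternating all lines

PM : List ℤ → Set
PM = All IsSign

-- Lists of signs without two consecutive `1ℤ`. Consecutive `-1ℤ` are allowed, since inserting `1ℤ`
-- can part them later.
data Separated : List ℤ → Set where
  []  : Separated []
  -∷  : ∀ {l} → Separated l → Separated (-1ℤ ∷ l)
  +[] : Separated [ 1ℤ ]
  +-∷ : ∀ {l} → Separated l → Separated (1ℤ ∷ -1ℤ ∷ l)

Separated⇒PM : ∀ {l} → Separated l → PM l
Separated⇒PM []      = []
Separated⇒PM (-∷ s)  = minus ∷ Separated⇒PM s
Separated⇒PM +[]     = plus ∷ []
Separated⇒PM (+-∷ s) = plus ∷ minus ∷ Separated⇒PM s

AltSeq⇒Separated : ∀ {l} → AltSeq l → Separated l
AltSeq⇒Separated single   = +[]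
AltSeq⇒Separated (cons s) = +-∷ (AltSeq⇒Separated s)

-- A `-1ℤ` goes in after every `1ℤ`; surplus negative entries do no harm at this stage.
separate : ∀ {l} → PM l → ∃[ l′ ] Insertions -1ℤ l l′ × Separated l′
separate [] = [] , done , []
separate (plus ∷ s) with separate s
... | _ , ch , s′ = _ , keep (add ch) , +-∷ s′
separate (minus ∷ s) with separate s
... | _ , ch , s′ = _ , keep ch , -∷ s′

-- A `1ℤ` goes in before each `-1ℤ` that does not directly follow a `1ℤ`, and at the end if the list
-- does not already end with `1ℤ`.
alternate : ∀ {l} → Separated l → ∃[ l′ ] Insertions 1ℤ l l′ × AltSeq l′
alternate []  = _ , add done , single
alternate +[] = _ , keep done , single
alternate (-∷ s) with alternate s
... | _ , ch , s′ = _ , add (keep ch) , cons s′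
alternate (+-∷ s) with alternate s
... | _ , ch , s′ = _ , keep (keep ch) , cons s′

AltOrEmpty : List ℤ → Set
AltOrEmpty l = l ≡ [] ⊎ AltSeq l

weaken₃ : ∀ {a b c F G} {A : Hyper a b c} → Lines F G AltSeq A → Lines F G AltOrEmpty A
weaken₃ (lines f g h) = lines f g (λ i j → inj₂ (h i j))

-- One pass per direction. Later passes add to finished directions only lines that are empty or a
-- lone `-1ℤ`, which are separated.
separateAll : ∀ {a b c} (A : Hyper a b c) → Lines PM PM PM A →
  ∃[ a′ ] ∃[ b′ ] ∃[ c′ ] Σ (Hyper a′ b′ c′) λ B → A ⟶ B × Lines Separated Separated Separated B
separateAll A₀ s₀
  with Repair.repair minus PM PM [] (minus ∷ []) [] (minus ∷ []) PM Separated Separated⇒PM separate A₀ s₀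
... | _ , A₁ , r₁ , s₁
  with Repair.repair minus PM Separated [] (minus ∷ []) [] (-∷ [])
         PM Separated Separated⇒PM separate (cyc A₁) (Lines-cyc s₁)
... | _ , A₂ , r₂ , s₂
  with Repair.repair minus Separated Separated [] (-∷ []) [] (-∷ [])
         PM Separated Separated⇒PM separate (cyc A₂) (Lines-cyc s₂)
... | _ , A₃ , r₃ , s₃ =
  -- Three rotations are the identity definitionally, so this chain starts at `A₀` itself.
  _ , _ , _ , cyc A₃ , ⟶-cyc (⟶-trans (⟶-cyc (⟶-trans (⟶-cyc r₁) r₂)) r₃) , Lines-cyc s₃

-- The new lines `[]` and `[ 1ℤ ]` are separated, so the remaining directions stay repairable. In
-- directions already repaired they may be empty, so only the last one keeps `AltSeq`.
alternateAll : ∀ {a b c} (A : Hyper a b c) → Lines Separated Separated Separated A →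
  ∃[ a′ ] ∃[ b′ ] ∃[ c′ ] Σ (Hyper a′ b′ c′) λ B → A ⟶ B × Lines AltOrEmpty AltOrEmpty AltSeq B
alternateAll A₀ s₀
  with Repair.repair plus Separated Separated [] +[] [] +[]
         Separated AltSeq AltSeq⇒Separated alternate A₀ s₀
... | _ , A₁ , r₁ , s₁
  with Repair.repair plus Separated AltOrEmpty [] +[] (inj₁ refl) (inj₂ single)
         Separated AltSeq AltSeq⇒Separated alternate (cyc A₁) (weaken₃ (Lines-cyc s₁))
... | _ , A₂ , r₂ , s₂
  with Repair.repair plus AltOrEmpty AltOrEmpty (inj₁ refl) (inj₂ single) (inj₁ refl) (inj₂ single)
         Separated AltSeq AltSeq⇒Separated alternate (cyc A₂) (weaken₃ (Lines-cyc s₂))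
... | _ , A₃ , r₃ , s₃ =
  _ , _ , _ , cyc A₃ , ⟶-cyc (⟶-trans (⟶-cyc (⟶-trans (⟶-cyc r₁) r₂)) r₃) , Lines-cyc s₃

-- König's edge colouring theorem

count : ∀ {n} → (Fin n → Bool) → ℕ
count {zero}  v = 0
count {suc n} v = (if v zero then 1 else 0) + count (v ∘ suc)

-- The rank of `i` among the positions holding `true`. Together with `count-index` it turns degrees
-- into pigeonhole arguments.
count-label : ∀ {n} (v : Fin n → Bool) i → v i ≡ true → Fin (count v)
count-label v zero    e with v zero
... | true = zero
count-label v (suc i) e with v zero
... | true  = suc (count-label (v ∘ suc) i e)
... | false = count-label (v ∘ suc) i e

count-label-injective : ∀ {n} (v : Fin n → Bool) i j e e′ → count-label v i e ≡ count-label v j e′ → i ≡ j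
count-label-injective v zero zero e e′ eq = refl
count-label-injective v zero (suc j) e e′ eq with v zero
count-label-injective v zero (suc j) e e′ () | true
count-label-injective v (suc i) zero e e′ eq with v zero
count-label-injective v (suc i) zero e e′ () | true
count-label-injective v (suc i) (suc j) e e′ eq with v zero
... | true  = cong suc (count-label-injective (v ∘ suc) i j e e′ (Fin.suc-injective eq))
... | false = cong suc (count-label-injective (v ∘ suc) i j e e′ eq)

count-index : ∀ {n} (v : Fin n → Bool) → Fin (count v) → Fin n
count-index {suc n} v t with v zero
count-index {suc n} v zero    | true  = zero
count-index {suc n} v (suc t) | true  = suc (count-index (v ∘ suc) t)
count-index {suc n} v t       | false = suc (count-index (v ∘ suc) t)

count-index-true : ∀ {n} (v : Fin n → Bool) t → v (count-index v t) ≡ true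
count-index-true {suc n} v t with v zero in v₀
count-index-true {suc n} v zero    | true  = v₀
count-index-true {suc n} v (suc t) | true  = count-index-true (v ∘ suc) t
count-index-true {suc n} v t       | false = count-index-true (v ∘ suc) t

count-index-injective : ∀ {n} (v : Fin n → Bool) s t → count-index v s ≡ count-index v t → s ≡ t
count-index-injective {suc n} v s t eq with v zero
count-index-injective {suc n} v zero    zero    eq | true = refl
count-index-injective {suc n} v (suc s) (suc t) eq | true =
  cong suc (count-index-injective (v ∘ suc) s t (Fin.suc-injective eq))
count-index-injective {suc n} v s t eq | false = count-index-injective (v ∘ suc) s t (Fin.suc-injective eq)

count≤ : ∀ {n} (v : Fin n → Bool) → count v ≤ n
count≤ v = Fin.injective⇒≤ (λ {s} {t} → count-index-injective v s t)

-- Orbits of partial injections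

Unique-lookup-injective : ∀ {A : Set} {l : List A} → Unique l → Injective _≡_ _≡_ (lookup l)
Unique-lookup-injective (_ ∷ _) {zero} {zero} eq = refl
Unique-lookup-injective (px ∷ _) {zero} {suc j} eq = contradiction eq (All.lookup px (∈-lookup j))
Unique-lookup-injective (px ∷ _) {suc i} {zero} eq = contradiction (sym eq) (All.lookup px (∈-lookup i))
Unique-lookup-injective (_ ∷ u) {suc i} {suc j} eq = cong suc (Unique-lookup-injective u eq)

-- The forward orbit of a source is a finite path: it cannot close up, as each vertex has at most
-- one predecessor and `y₀` has none. Listing the path makes membership decidable.
module Orbit {q : ℕ} (_~>_ : Fin q → Fin q → Set) (_~>?_ : ∀ y z → Dec (y ~> z))
  (functional : ∀ {y z z′} → y ~> z → y ~> z′ → z ≡ z′)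
  (injective : ∀ {y y′ z} → y ~> z → y′ ~> z → y ≡ y′)
  (y₀ : Fin q) (source : ∀ {z} → ¬ (z ~> y₀)) where

  -- The index list holds the vertices before the endpoint, latest first.
  data Path : Fin q → List (Fin q) → Set where
    start : Path y₀ []
    step  : ∀ {y z l} → z ~> y → Path z l → Path y (z ∷ l)

  pred∈tail : ∀ {w l y z} → Path w l → y ∈ w ∷ l → z ~> y → z ∈ l
  pred∈tail start       (here refl) z~>y = contradiction z~>y source
  pred∈tail (step w~> _) (here refl) z~>y = here (injective z~>y w~>)
  pred∈tail (step _ π)  (there y∈)  z~>y = there (pred∈tail π y∈ z~>y)

  succ∈ : ∀ {w l y z} → Path w l → y ∈ l → y ~> z → z ∈ w ∷ l
  succ∈ (step v~>w _) (here refl) y~>z = here (functional y~>z v~>w)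
  succ∈ (step _ π)    (there y∈)  y~>z = there (succ∈ π y∈ y~>z)

  hasPred : ∀ {w l y} → Path w l → y ∈ w ∷ l → y ≡ y₀ ⊎ ∃[ z ] z ~> y
  hasPred start        (here refl) = inj₁ refl
  hasPred (step z~> _) (here refl) = inj₂ (_ , z~>)
  hasPred (step _ π)   (there y∈)  = hasPred π y∈

  -- The fuel `n` plus the number of vertices is `suc q`; running out would give `suc q` distinct
  -- elements of `Fin q`.
  extend : ∀ n {w l} → Path w l → Unique (w ∷ l) → n + length (w ∷ l) ≡ suc q →
    ∃[ w′ ] ∃[ l′ ] Path w′ l′ × (∀ z → ¬ (w′ ~> z))
  extend zero π u eq = contradiction
    (subst (_≤ q) eq (Fin.injective⇒≤ (Unique-lookup-injective u))) ℕ.1+n≰n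
  extend (suc n) {w} {l} π u@(w∉l ∷ _) eq with Fin.any? (w ~>?_)
  ... | no none = w , l , π , (λ z w~>z → none (z , w~>z))
  ... | yes (z , w~>z) = extend n (step w~>z π) (All.tabulate fresh ∷ u) (trans (ℕ.+-suc n _) eq)
    where
    fresh : ∀ {y} → y ∈ w ∷ l → z ≢ y
    -- If the successor of `w` were on the path, its predecessor `w` would already occur in `l`.
    fresh y∈ refl = contradiction refl (All.lookup w∉l (pred∈tail π y∈ w~>z))

  maximal : ∃[ w ] ∃[ l ] Path w l × (∀ z → ¬ (w ~> z))
  maximal = extend q start ([] ∷ []) (ℕ.+-comm q 1)

  private
    w = proj₁ maximal
    l = proj₁ (proj₂ maximal)
    π = proj₁ (proj₂ (proj₂ maximal))
    w-last = proj₂ (proj₂ (proj₂ maximal))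

  Orb : Fin q → Set
  Orb y = y ∈ w ∷ l

  Orb? : ∀ y → Dec (Orb y)
  Orb? y = any? (y ≟_) (w ∷ l)

  Orb-start : Orb y₀
  Orb-start = go π
    where
    go : ∀ {w l} → Path w l → y₀ ∈ w ∷ l
    go start      = here refl
    go (step _ π) = there (go π)

  Orb-succ : ∀ {y z} → y ~> z → Orb y → Orb z
  Orb-succ y~>z (here refl) = contradiction y~>z (w-last _)
  Orb-succ y~>z (there y∈)  = succ∈ π y∈ y~>z

  Orb-pred : ∀ {y z} → y ~> z → Orb z → Orb y
  Orb-pred y~>z z∈ = there (pred∈tail π z∈ y~>z)

  Orb-origin : ∀ {y} → Orb y → y ≡ y₀ ⊎ ∃[ z ] z ~> y
  Orb-origin = hasPred π

-- Proper edge colourings and Kempe exchanges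

Colouring : ℕ → ℕ → ℕ → Set
Colouring p q Δ = Fin p → Fin q → Maybe (Fin Δ)

record Proper {p q Δ} (col : Colouring p q Δ) : Set where
  constructor proper
  field
    row    : ∀ {x y y′ t} → col x y ≡ just t → col x y′ ≡ just t → y ≡ y′
    column : ∀ {x x′ y t} → col x y ≡ just t → col x′ y ≡ just t → x ≡ x′

_≟ᴹ_ : ∀ {n} (u w : Maybe (Fin n)) → Dec (u ≡ w)
_≟ᴹ_ = Maybe.≡-dec _≟_

transpose-left : ∀ {n} (α β : Fin n) → transpose α β α ≡ β
transpose-left α β with α ≟ α
... | yes _ = refl
... | no ne = contradiction refl ne

transpose-right : ∀ {n} (α β : Fin n) → transpose α β β ≡ α
transpose-right α β with β ≟ α
... | yes e = e
... | no _ with β ≟ β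
...   | yes _ = refl
...   | no ne = contradiction refl ne

transpose-other : ∀ {n} (α β t : Fin n) → t ≢ α → t ≢ β → transpose α β t ≡ t
transpose-other α β t t≢α t≢β with t ≟ α
... | yes e = contradiction e t≢α
... | no _ with t ≟ β
...   | yes e = contradiction e t≢β
...   | no _  = refl

-- Exchanging `α` and `β` along the chain from `y₀` makes `α` free at both `x₀` and `y₀`, so an edge
-- joining them can take it.
module Kempe {p q Δ : ℕ} (col : Colouring p q Δ) (col-proper : Proper col) (α β : Fin Δ) (x₀ : Fin p) (y₀ : Fin q)
  (α∉x₀ : ∀ y → col x₀ y ≢ just α) (β∉y₀ : ∀ x → col x y₀ ≢ just β) where
  open Proper col-proper

  -- The orbit of y₀ under _~>_ is the set of columns on the Kempe chain from y₀; the chain misses row x₀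
  -- because it could enter that row only along an edge coloured α.
  _~>_ : Fin q → Fin q → Set
  y ~> z = ∃[ x ] (col x y ≡ just α × col x z ≡ just β)

  _~>?_ : ∀ y z → Dec (y ~> z)
  y ~>? z = Fin.any? (λ x → (col x y ≟ᴹ just α) ×-dec (col x z ≟ᴹ just β))

  ~>-functional : ∀ {y z z′} → y ~> z → y ~> z′ → z ≡ z′
  ~>-functional (_ , e , f) (_ , e′ , f′) = row f (subst (λ x → col x _ ≡ just β) (column e′ e) f′)

  ~>-injective : ∀ {y y′ z} → y ~> z → y′ ~> z → y ≡ y′
  ~>-injective (_ , e , f) (_ , e′ , f′) = row e (subst (λ x → col x _ ≡ just α) (column f′ f) e′)

  y₀-source : ∀ {z} → ¬ (z ~> y₀)
  y₀-source (x , _ , f) = β∉y₀ x f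

  open Orbit _~>_ _~>?_ ~>-functional ~>-injective y₀ y₀-source

  -- Acting on whole columns of the orbit recolours just the chain, because the transposition fixes
  -- all other colours.
  swapped : Colouring p q Δ
  swapped x y with Orb? y
  ... | yes _ = Maybe.map (transpose α β) (col x y)
  ... | no _  = col x y

  private
    map⁻ : ∀ {u t} → Maybe.map (transpose α β) u ≡ just t → u ≡ just (transpose β α t)
    map⁻ {just s} refl = cong just (sym (transpose-inverse β α))

  swapped-Orb : ∀ {x y t} → Orb y → swapped x y ≡ just t → col x y ≡ just (transpose β α t)
  swapped-Orb {y = y} o e with Orb? y
  ... | yes _ = map⁻ e
  ... | no ¬o = contradiction o ¬o

  swapped-just⁺ : ∀ {x y t} → col x y ≡ just t → ∃[ s ] swapped x y ≡ just s
  swapped-just⁺ {y = y} e with Orb? y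
  ... | yes _ = _ , cong (Maybe.map (transpose α β)) e
  ... | no _  = _ , e

  swapped-just⁻ : ∀ {x y t} → swapped x y ≡ just t → ∃[ s ] col x y ≡ just s
  swapped-just⁻ {y = y} e with Orb? y
  ... | yes _ = _ , map⁻ e
  ... | no _  = _ , e

  private
    -- A clash in `α` or `β` between a column inside the orbit and one outside would link the two by
    -- `_~>_`, but the orbit is closed in both directions. Other colours are unaffected.
    mixed : ∀ {x y y′ t} → Dec (t ≡ α) → Dec (t ≡ β) → Orb y → ¬ Orb y′ →
      col x y ≡ just (transpose β α t) → col x y′ ≡ just t → y ≡ y′
    mixed (yes refl) _ o ¬o e e′ =
      contradiction (Orb-pred (_ , e′ , trans e (cong just (transpose-right β α))) o) ¬o
    mixed (no _) (yes refl) o ¬o e e′ =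
      contradiction (Orb-succ (_ , trans e (cong just (transpose-left β α)) , e′) o) ¬o
    mixed {t = t} (no t≢α) (no t≢β) o ¬o e e′ =
      row (trans e (cong just (transpose-other β α t t≢β t≢α))) e′

  swapped-proper : Proper swapped
  swapped-proper = proper (λ {x} {y} {y′} → row′ {x} {y} {y′}) (λ {x} {x′} {y} → column′ {x} {x′} {y})
    where
    row′ : ∀ {x y y′ t} → swapped x y ≡ just t → swapped x y′ ≡ just t → y ≡ y′
    row′ {y = y} {y′} {t} e e′ with Orb? y | Orb? y′
    ... | yes o | yes o′ = row (map⁻ e) (map⁻ e′)
    ... | yes o | no ¬o  = mixed (t ≟ α) (t ≟ β) o ¬o (map⁻ e) e′
    ... | no ¬o | yes o  = sym (mixed (t ≟ α) (t ≟ β) o ¬o (map⁻ e′) e)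
    ... | no _  | no _   = row e e′
    column′ : ∀ {x x′ y t} → swapped x y ≡ just t → swapped x′ y ≡ just t → x ≡ x′
    column′ {y = y} e e′ with Orb? y
    ... | yes _ = column (map⁻ e) (map⁻ e′)
    ... | no _  = column e e′

  -- A new `α` in row `x₀` was a `β` in an orbit column. That column is not `y₀`, so the chain
  -- entered it along this `β`, hence through row `x₀` by an edge coloured `α`.
  α∉x₀-swapped : ∀ y → swapped x₀ y ≢ just α
  α∉x₀-swapped y e with Orb? y
  ... | no _ = α∉x₀ y e
  ... | yes o with trans (map⁻ e) (cong just (transpose-right β α)) | Orb-origin o
  ...   | x₀y≡β | inj₁ refl = β∉y₀ x₀ x₀y≡β
  ...   | x₀y≡β | inj₂ (z , x , xz≡α , xy≡β) =
    α∉x₀ z (subst (λ x → col x z ≡ just α) (column xy≡β x₀y≡β) xz≡α)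

  α∉y₀-swapped : ∀ x → swapped x y₀ ≢ just α
  α∉y₀-swapped x e = β∉y₀ x (trans (swapped-Orb Orb-start e) (cong just (transpose-right β α)))

-- If every colour occurred, its edges and the uncoloured edge `i₀` would be `suc Δ` distinct edges
-- at one vertex.
unusedColour : ∀ {n Δ} (v : Fin n → Bool) (w : Fin n → Maybe (Fin Δ)) → count v ≤ Δ →
  (∀ {i t} → w i ≡ just t → v i ≡ true) → ∀ i₀ → v i₀ ≡ true → w i₀ ≡ nothing → ∃[ α ] (∀ i → w i ≢ just α)
unusedColour {n} {Δ} v w deg coloured⇒edge i₀ vi₀ wi₀
  with Fin.any? (λ α → ¬? (Fin.any? (λ i → w i ≟ᴹ just α)))
... | yes (α , unused) = α , (λ i e → unused (i , e))
... | no all-used = contradiction (ℕ.≤-trans (Fin.injective⇒≤ label-injective) deg) ℕ.1+n≰n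
  where
  used : ∀ α → ∃[ i ] w i ≡ just α
  used α with Fin.any? (λ i → w i ≟ᴹ just α)
  ... | yes u = u
  ... | no ¬u = contradiction (α , ¬u) all-used
  g : Fin (suc Δ) → ∃[ i ] v i ≡ true
  g zero    = i₀ , vi₀
  g (suc α) = proj₁ (used α) , coloured⇒edge (proj₂ (used α))
  g-injective : ∀ s t → proj₁ (g s) ≡ proj₁ (g t) → s ≡ t
  g-injective zero    zero    eq = refl
  g-injective zero    (suc β) eq with trans (sym (trans (cong w eq) (proj₂ (used β)))) wi₀
  ... | ()
  g-injective (suc α) zero    eq with trans (sym (trans (cong w (sym eq)) (proj₂ (used α)))) wi₀
  ... | ()
  g-injective (suc α) (suc β) eq =
    cong suc (just-injective (trans (sym (proj₂ (used α))) (trans (cong w eq) (proj₂ (used β)))))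
  label-injective : Injective _≡_ _≡_ (λ t → count-label v (proj₁ (g t)) (proj₂ (g t)))
  label-injective {s} {t} eq = g-injective s t (count-label-injective v _ _ _ _ eq)

-- Were `α` missing, `punchOut` would squeeze the distinct colours of all edges at the vertex into a
-- palette with one colour fewer than its degree.
allColoursUsed : ∀ {n Δ} (v : Fin n → Bool) (w : Fin n → Maybe (Fin Δ)) → count v ≡ Δ →
  (∀ i → v i ≡ true → ∃[ t ] w i ≡ just t) → (∀ {i j t} → w i ≡ just t → w j ≡ just t → i ≡ j) →
  ∀ α → ∃[ i ] w i ≡ just α
allColoursUsed {Δ = suc Δ} v w deg edge⇒coloured uniq α with Fin.any? (λ i → w i ≟ᴹ just α)
... | yes u = u
... | no ¬u = contradiction (subst (_≤ Δ) deg (Fin.injective⇒≤ colour-injective)) ℕ.1+n≰n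
  where
  colour : ∀ s → ∃[ t ] w (count-index v s) ≡ just t
  colour s = edge⇒coloured (count-index v s) (count-index-true v s)
  avoids : ∀ s → α ≢ proj₁ (colour s)
  avoids s eq = ¬u (_ , trans (proj₂ (colour s)) (cong just (sym eq)))
  colour-injective : Injective _≡_ _≡_ (λ s → punchOut (avoids s))
  colour-injective {s} {t} eq = count-index-injective v s t
    (uniq (proj₂ (colour s)) (trans (proj₂ (colour t)) (cong just (sym (Fin.punchOut-injective (avoids s) (avoids t) eq)))))

-- `M` is the biadjacency matrix of a bipartite graph of maximum degree at most `Δ`; its edges are
-- coloured one at a time.
module Koenig {p q Δ : ℕ} (M : Fin p → Fin q → Bool)
  (rowDegree : ∀ x → count (M x) ≤ Δ) (columnDegree : ∀ y → count (λ x → M x y) ≤ Δ) where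

  record Partial (col : Colouring p q Δ) : Set where
    field
      isProper      : Proper col
      coloured⇒edge : ∀ {x y t} → col x y ≡ just t → M x y ≡ true

  Coloured : Colouring p q Δ → Fin p × Fin q → Set
  Coloured col (x , y) = ∃[ t ] col x y ≡ just t

  assign : Colouring p q Δ → Fin Δ → Fin p × Fin q → Colouring p q Δ
  assign col α e x y with ≡-dec _≟_ _≟_ (x , y) e
  ... | yes _ = just α
  ... | no _  = col x y

  assign-partial : ∀ {col α x₀ y₀} → Partial col → M x₀ y₀ ≡ true →
    (∀ y → col x₀ y ≢ just α) → (∀ x → col x y₀ ≢ just α) → Partial (assign col α (x₀ , y₀))
  assign-partial {col} {α} {x₀} {y₀} P edge α∉x₀ α∉y₀ =
    record { isProper = proper (λ {x} {y} {y′} → row′ {x} {y} {y′}) (λ {x} {x′} {y} → column′ {x} {x′} {y}) ; coloured⇒edge = edge′ }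
    where
    open Partial P
    open Proper isProper
    row′ : ∀ {x y y′ t} → assign col α (x₀ , y₀) x y ≡ just t → assign col α (x₀ , y₀) x y′ ≡ just t → y ≡ y′
    row′ {x} {y} {y′} e e′ with ≡-dec _≟_ _≟_ (x , y) (x₀ , y₀) | ≡-dec _≟_ _≟_ (x , y′) (x₀ , y₀)
    row′ e    e′   | yes refl | yes refl = refl
    row′ refl e′   | yes refl | no _     = contradiction e′ (α∉x₀ _)
    row′ e    refl | no _     | yes refl = contradiction e (α∉x₀ _)
    row′ e    e′   | no _     | no _     = row e e′
    column′ : ∀ {x x′ y t} → assign col α (x₀ , y₀) x y ≡ just t → assign col α (x₀ , y₀) x′ y ≡ just t → x ≡ x′
    column′ {x} {x′} {y} e e′ with ≡-dec _≟_ _≟_ (x , y) (x₀ , y₀) | ≡-dec _≟_ _≟_ (x′ , y) (x₀ , y₀)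
    column′ e    e′   | yes refl | yes refl = refl
    column′ refl e′   | yes refl | no _     = contradiction e′ (α∉y₀ _)
    column′ e    refl | no _     | yes refl = contradiction e (α∉y₀ _)
    column′ e    e′   | no _     | no _     = column e e′
    edge′ : ∀ {x y t} → assign col α (x₀ , y₀) x y ≡ just t → M x y ≡ true
    edge′ {x} {y} e with ≡-dec _≟_ _≟_ (x , y) (x₀ , y₀)
    ... | yes refl = edge
    ... | no _     = coloured⇒edge e

  assign-here : ∀ col α x y → assign col α (x , y) x y ≡ just α
  assign-here col α x y with ≡-dec _≟_ _≟_ (x , y) (x , y)
  ... | yes _ = refl
  ... | no ne = contradiction refl ne

  assign-mono : ∀ {col} α e e′ → Coloured col e′ → Coloured (assign col α e) e′
  assign-mono α e (x , y) c with ≡-dec _≟_ _≟_ (x , y) e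
  ... | yes _ = α , refl
  ... | no _  = c

  -- The edge is uncoloured, so each end has a free colour, and a Kempe exchange makes one colour
  -- free at both. Other edges may change colour but stay coloured.
  colourEdge : ∀ {col} → Partial col → ∀ x y → M x y ≡ true →
    ∃[ col′ ] Partial col′ × Coloured col′ (x , y) × (∀ e → Coloured col e → Coloured col′ e)
  colourEdge {col} P x y edge with col x y in xy
  ... | just t = col , P , (t , xy) , (λ _ c → c)
  ... | nothing with unusedColour (M x) (col x) (rowDegree x) (Partial.coloured⇒edge P) y edge xy
                   | unusedColour (λ x → M x y) (λ x → col x y) (columnDegree y) (Partial.coloured⇒edge P) x edge xy
  ...   | α , α∉x | β , β∉y =
    assign swapped α (x , y) ,
    assign-partial P′ edge α∉x₀-swapped α∉y₀-swapped ,
    (α , assign-here swapped α x y) ,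
    (λ e c → assign-mono α (x , y) e (swapped-just⁺ (proj₂ c)))
    where
    open Kempe col (Partial.isProper P) α β x y α∉x β∉y
    P′ : Partial swapped
    P′ = record
      { isProper = swapped-proper
      ; coloured⇒edge = λ e → Partial.coloured⇒edge P (proj₂ (swapped-just⁻ e)) }

  colourEdges : ∀ es → ∃[ col ] Partial col × (∀ {x y} → (x , y) ∈ es → M x y ≡ true → Coloured col (x , y))
  colourEdges [] = (λ _ _ → nothing) ,
    record { isProper = proper (λ ()) (λ ()) ; coloured⇒edge = λ () } , (λ ())
  colourEdges ((x , y) ∷ es) with colourEdges es | M x y in Mxy
  ... | col , P , c | false = col , P , c′
    where
    c′ : ∀ {x′ y′} → (x′ , y′) ∈ (x , y) ∷ es → M x′ y′ ≡ true → Coloured col (x′ , y′)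
    c′ (here refl) edge with trans (sym Mxy) edge
    ... | ()
    c′ (there e∈) edge = c e∈ edge
  ... | col , P , c | true with colourEdge P x y Mxy
  ...   | col′ , P′ , cxy , mono = col′ , P′ , c′
    where
    c′ : ∀ {x′ y′} → (x′ , y′) ∈ (x , y) ∷ es → M x′ y′ ≡ true → Coloured col′ (x′ , y′)
    c′ (here refl) edge = cxy
    c′ (there e∈) edge = mono _ (c e∈ edge)

  edgeColouring : ∃[ col ] Partial col × (∀ x y → M x y ≡ true → Coloured col (x , y))
  edgeColouring with colourEdges (cartesianProduct (allFin p) (allFin q))
  ... | col , P , c = col , P , (λ x y → c (∈-cartesianProduct⁺ (∈-allFin x) (∈-allFin y)))

-- Completion to an alternating sign hypermatrix

front : ∀ {a} {X : Set} Δ → (Fin Δ → X) → (Fin a → X) → Fin (Δ + a) → X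
front zero    P A i       = A i
front (suc Δ) P A zero    = P zero
front (suc Δ) P A (suc i) = front Δ (P ∘ suc) A i

front-rel : ∀ {a} {X Y : Set} (_~_ : X → Y → Set) Δ (P : Fin Δ → X) (A : Fin a → X) (P′ : Fin Δ → Y) (A′ : Fin a → Y) →
  (∀ t → P t ~ P′ t) → (∀ i → A i ~ A′ i) → ∀ i → front Δ P A i ~ front Δ P′ A′ i
front-rel _~_ zero    P A P′ A′ p r i       = r i
front-rel _~_ (suc Δ) P A P′ A′ p r zero    = p zero
front-rel _~_ (suc Δ) P A P′ A′ p r (suc i) = front-rel _~_ Δ (P ∘ suc) A (P′ ∘ suc) A′ (p ∘ suc) r i

nonzeros-front : ∀ {a} Δ (u : Fin Δ → ℤ) (v : Fin a → ℤ) → nonzeros (front Δ u v) ≡ nonzeros u ++ nonzeros v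
nonzeros-front zero u v = refl
nonzeros-front (suc Δ) u v with u zero ℤ.≟ 0ℤ
... | yes _ = nonzeros-front Δ (u ∘ suc) v
... | no _  = cong (u zero ∷_) (nonzeros-front Δ (u ∘ suc) v)

nonzeros-front-line : ∀ {a b c} Δ (P : Hyper Δ b c) (A : Hyper a b c) j k →
  nonzeros (λ i → front Δ P A i j k) ≡ nonzeros (λ t → P t j k) ++ nonzeros (λ i → A i j k)
nonzeros-front-line Δ P A j k = trans
  (nonzeros-cong (front-rel (λ X y → X j k ≡ y) Δ P A (λ t → P t j k) (λ i → A i j k) (λ _ → refl) (λ _ → refl)))
  (nonzeros-front Δ (λ t → P t j k) (λ i → A i j k))

-- The planes go in at position `zero`, the last one first.
⟶-front : ∀ {a b c} Δ (P : Hyper Δ b c) (A : Hyper a b c) → (∀ t → IsSignedSubPerm (P t)) → A ⟶ front Δ P A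
⟶-front zero P A s = ⟶-reflexive (λ _ _ _ → refl)
⟶-front (suc Δ) P A s = ⟶-trans (⟶-front Δ (P ∘ suc) A (s ∘ suc))
  (⟶-trans (⟶-ins (front Δ (P ∘ suc) A) zero (P zero) (s zero)) (⟶-reflexive e))
  where
  e : ins zero (P zero) (front Δ (P ∘ suc) A) ≋ front (suc Δ) P A
  e zero    j k = refl
  e (suc i) j k = refl

foldr-AltSeq : ∀ {l} → AltSeq l → foldr ℤ._+_ 0ℤ l ≡ 1ℤ
foldr-AltSeq single = refl
foldr-AltSeq (cons s) rewrite foldr-AltSeq s = refl

sum-nonzeros : ∀ {n} (v : Fin n → ℤ) → sum v ≡ foldr ℤ._+_ 0ℤ (nonzeros v)
sum-nonzeros {zero}  v = refl
sum-nonzeros {suc n} v with v zero ℤ.≟ 0ℤ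
... | yes z = trans (cong₂ ℤ._+_ z (sum-nonzeros (v ∘ suc))) (ℤ.+-identityˡ _)
... | no _  = cong (λ s → v zero ℤ.+ s) (sum-nonzeros (v ∘ suc))

sum-AltSeq : ∀ {n} (v : Fin n → ℤ) → AltSeq (nonzeros v) → sum v ≡ 1ℤ
sum-AltSeq v s = trans (sum-nonzeros v) (foldr-AltSeq s)

sum-ones : ∀ n → ∑[ i < n ] 1ℤ ≡ + n
sum-ones zero    = refl
sum-ones (suc n) = cong (λ s → 1ℤ ℤ.+ s) (sum-ones n)

indicator : Bool → ℤ
indicator v = + (if v then 1 else 0)

count-sum : ∀ {n} (v : Fin n → Bool) → + count v ≡ ∑[ i < n ] indicator (v i)
count-sum {zero}  v = refl
count-sum {suc n} v = cong (λ s → indicator (v zero) ℤ.+ s) (count-sum (v ∘ suc))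

-- Both families of lines have the total of W as sum: there are a rows, and b minus the number of empty columns.
count-empty : ∀ {a b} (W : Fin a → Fin b → ℤ) → (∀ i → AltSeq (nonzeros (W i))) →
  (∀ j → AltOrEmpty (nonzeros (λ i → W i j))) → count (λ j → null (nonzeros (λ i → W i j))) + a ≡ b
count-empty {a} {b} W rows columns = ℤ.+-injective (begin
  + count E ℤ.+ + a                                             ≡⟨ cong₂ ℤ._+_ (count-sum E) (sym (sum-ones a)) ⟩
  ∑[ j < b ] indicator (E j) ℤ.+ ∑[ i < a ] 1ℤ                  ≡⟨ cong (λ s → ∑[ j < b ] indicator (E j) ℤ.+ s)
                                                                     (sum-cong-≗ (λ i → sym (sum-AltSeq (W i) (rows i)))) ⟩
  ∑[ j < b ] indicator (E j) ℤ.+ ∑[ i < a ] ∑[ j < b ] W i j    ≡⟨ cong (λ s → ∑[ j < b ] indicator (E j) ℤ.+ s) (∑-comm W) ⟩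
  ∑[ j < b ] indicator (E j) ℤ.+ ∑[ j < b ] ∑[ i < a ] W i j    ≡⟨ sym (∑-distrib-+ (indicator ∘ E) (λ j → ∑[ i < a ] W i j)) ⟩
  ∑[ j < b ] (indicator (E j) ℤ.+ ∑[ i < a ] W i j)             ≡⟨ sum-cong-≗ one ⟩
  ∑[ j < b ] 1ℤ                                                 ≡⟨ sum-ones b ⟩
  + b                                                           ∎)
  where
  open ≡-Reasoning
  E : Fin b → Bool
  E j = null (nonzeros (λ i → W i j))
  one′ : ∀ {l} → AltOrEmpty l → indicator (null l) ℤ.+ foldr ℤ._+_ 0ℤ l ≡ 1ℤ
  one′ (inj₁ refl)            = refl
  one′ (inj₂ single)          = refl
  one′ (inj₂ s@(cons _))      = trans (ℤ.+-identityˡ _) (foldr-AltSeq s)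
  one : ∀ j → indicator (E j) ℤ.+ ∑[ i < a ] W i j ≡ 1ℤ
  one j = trans (cong (λ s → indicator (E j) ℤ.+ s) (sum-nonzeros (λ i → W i j))) (one′ (columns j))

colourClass : ∀ {p q Δ} → Colouring p q Δ → Hyper Δ p q
colourClass col t x y with col x y ≟ᴹ just t
... | yes _ = 1ℤ
... | no _  = 0ℤ

module _ {p q Δ : ℕ} (col : Colouring p q Δ) where

  colourClass-values : ∀ t x y → colourClass col t x y ≡ 0ℤ ⊎ colourClass col t x y ≡ 1ℤ
  colourClass-values t x y with col x y ≟ᴹ just t
  ... | yes _ = inj₂ refl
  ... | no _  = inj₁ refl

  colourClass-1⁻ : ∀ t x y → colourClass col t x y ≡ 1ℤ → col x y ≡ just t
  colourClass-1⁻ t x y e with col x y ≟ᴹ just t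
  ... | yes eq = eq
  colourClass-1⁻ t x y () | no _

  colourClass-1⁺ : ∀ t x y → col x y ≡ just t → colourClass col t x y ≡ 1ℤ
  colourClass-1⁺ t x y e with col x y ≟ᴹ just t
  ... | yes _ = refl
  ... | no ne = contradiction e ne

  colourClass-IsSubPerm : Proper col → ∀ t → IsSubPerm (colourClass col t)
  colourClass-IsSubPerm (proper row column) t = colourClass-values t ,
    (λ x y y′ e e′ → row (colourClass-1⁻ t x y e) (colourClass-1⁻ t x y′ e′)) ,
    (λ x x′ y e e′ → column (colourClass-1⁻ t x y e) (colourClass-1⁻ t x′ y e′))

1≢0 : 1ℤ ≢ 0ℤ
1≢0 ()

-- The empty lines `(j , k)` are the edges of a bipartite graph, and its colour classes become the
-- new planes. Each empty line gets exactly one `1ℤ`. Every column has degree `Δ`, so it meets every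
-- colour and the new lines of the second direction are `[ 1ℤ ]`. A row of degree `Δ` does likewise
-- for the third; other rows may miss a colour, so `H []` is required there.
complete : ∀ {a b c Δ} {H : List ℤ → Set} (A : Hyper a b c) → Lines AltOrEmpty AltSeq H A → Δ + a ≡ b →
  (let degree = λ j → count (λ k → null (nonzeros (λ i → A i j k)))) →
  (∀ j → degree j ≤ Δ) → H [ 1ℤ ] → (∀ j → H [] ⊎ degree j ≡ Δ) →
  Σ (Hyper (Δ + a) b c) λ B → A ⟶ B × Lines AltSeq AltSeq H B
complete {a} {b} {c} {Δ} {H} A (lines f g h) Δ+a≡b rowDegree H1 H0 =
  front Δ P A , ⟶-front Δ P A (λ t → P t , subPerm t , inj₁ (λ _ _ → refl)) , lines f′ g′ h′
  where
  D : Fin b → Fin c → Bool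
  D j k = null (nonzeros (λ i → A i j k))

  -- Counting in the slice at `k` gives degree plus `a` equal to `b`, which is `Δ + a`.
  columnDegree : ∀ k → count (λ j → D j k) ≡ Δ
  columnDegree k = ℕ.+-cancelʳ-≡ a _ Δ
    (trans (count-empty (λ i j → A i j k) (g k) (λ j → f j k)) (sym Δ+a≡b))

  open Koenig D rowDegree (λ k → ℕ.≤-reflexive (columnDegree k))

  col = proj₁ edgeColouring
  open Partial (proj₁ (proj₂ edgeColouring))
  open Proper isProper
  edge⇒coloured = proj₂ (proj₂ edgeColouring)

  P : Hyper Δ b c
  P = colourClass col

  subPerm : ∀ t → IsSubPerm (P t)
  subPerm = colourClass-IsSubPerm col isProper

  f′ : ∀ j k → AltSeq (nonzeros (λ i → front Δ P A i j k))
  f′ j k = subst AltSeq (sym (nonzeros-front-line Δ P A j k)) (go (f j k) refl)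
    where
    go : ∀ {l} → AltOrEmpty l → nonzeros (λ i → A i j k) ≡ l → AltSeq (nonzeros (λ t → P t j k) ++ l)
    go (inj₁ refl) e with edge⇒coloured j k (cong null e)
    ... | t , jk≡t = subst (λ l → AltSeq (l ++ [])) (sym (nonzeros-exactlyOne (λ t → P t j k) 1≢0
            (λ t → colourClass-values col t j k)
            (λ s t e e′ → just-injective (trans (sym (colourClass-1⁻ col s j k e)) (colourClass-1⁻ col t j k e′)))
            (t , colourClass-1⁺ col t j k jk≡t))) single
    go {l} (inj₂ s) e = subst (λ l′ → AltSeq (l′ ++ l)) (sym (nonzeros-empty (λ t → P t j k) z)) s
      where
      nonempty : ∀ {l} → AltSeq l → null l ≢ true
      nonempty single ()
      nonempty (cons _) ()
      z : ∀ t → P t j k ≡ 0ℤ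
      z t with colourClass-values col t j k
      ... | inj₁ e₀ = e₀
      ... | inj₂ e₁ = contradiction (trans (cong null (sym e)) (coloured⇒edge (colourClass-1⁻ col t j k e₁))) (nonempty s)

  g′ : ∀ k i → AltSeq (nonzeros (λ j → front Δ P A i j k))
  g′ k = front-rel (λ X Y → AltSeq (nonzeros (λ j → X j k))) Δ P A P A new (g k)
    where
    new : ∀ t → AltSeq (nonzeros (λ j → P t j k))
    new t with allColoursUsed (λ j → D j k) (λ j → col j k) (columnDegree k) (λ j → edge⇒coloured j k) column t
    ... | j , jk≡t = subst AltSeq (sym (nonzeros-exactlyOne (λ j → P t j k) 1≢0 (λ j → colourClass-values col t j k)
            (λ j j′ → proj₂ (proj₂ (subPerm t)) j j′ k) (j , colourClass-1⁺ col t j k jk≡t))) single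

  h′ : ∀ i j → H (nonzeros (λ k → front Δ P A i j k))
  h′ i j = front-rel (λ X Y → H (nonzeros (λ k → X j k))) Δ P A P A new (λ i → h i j) i
    where
    uniq : ∀ t k k′ → P t j k ≡ 1ℤ → P t j k′ ≡ 1ℤ → k ≡ k′
    uniq t = proj₁ (proj₂ (subPerm t)) j
    new : ∀ t → H (nonzeros (P t j))
    new t with H0 j
    ... | inj₂ full with allColoursUsed (D j) (col j) full (edge⇒coloured j) row t
    ...   | k , jk≡t = subst H (sym (nonzeros-exactlyOne (P t j) 1≢0 (colourClass-values col t j) (uniq t)
              (k , colourClass-1⁺ col t j k jk≡t))) H1
    new t | inj₁ H[] with nonzeros-atMostOne (P t j) 1≢0 (colourClass-values col t j) (uniq t)
    ...   | inj₁ e = subst H (sym e) H[]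
    ...   | inj₂ e = subst H (sym e) H1

-- The zero matrix is a subpermutation matrix, so zero planes can enlarge a dimension wherever the
-- other two directions tolerate empty lines.
pad : ∀ {a b c G H} t (A : Hyper a b c) → G [] → H [] → Lines AltSeq G H A →
  Σ (Hyper (t + a) b c) λ B → A ⟶ B × Lines AltSeq G H B
pad {b = b} {c} {G} {H} t A G[] H[] (lines f g h) =
  front t Z A ,
  ⟶-front t Z A (λ _ → (λ _ _ → 0ℤ) , ((λ _ _ → inj₁ refl) , (λ _ _ _ ()) , (λ _ _ _ ())) , inj₁ (λ _ _ → refl)) ,
  lines
    (λ j k → subst AltSeq (sym (trans (nonzeros-front-line t Z A j k)
       (cong (_++ nonzeros (λ i → A i j k)) (nonzeros-empty {t} (λ _ → 0ℤ) (λ _ → refl))))) (f j k))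
    (λ k → front-rel (λ X Y → G (nonzeros (λ j → X j k))) t Z A Z A
       (λ _ → subst G (sym (nonzeros-empty {b} (λ _ → 0ℤ) (λ _ → refl))) G[]) (g k))
    (λ i j → front-rel (λ X Y → H (nonzeros (λ k → X j k))) t Z A Z A
       (λ _ → subst H (sym (nonzeros-empty {c} (λ _ → 0ℤ) (λ _ → refl))) H[]) (λ i → h i j) i)
  where
  Z : Hyper t b c
  Z _ _ _ = 0ℤ

-- This is the Ryser step: a row of the graph has only `a` cells, so `a ≤ Δ` bounds its degree.
fillMiddle : ∀ {a b n Δ} (A : Hyper b n a) → Lines AltOrEmpty AltSeq AltOrEmpty A → Δ + b ≡ n → a ≤ Δ →
  Σ (Hyper n n a) λ B → A ⟶ B × Lines AltSeq AltSeq AltOrEmpty B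
fillMiddle A s refl a≤Δ =
  complete A s refl (λ j → ℕ.≤-trans (count≤ _) a≤Δ) (inj₂ single) (λ _ → inj₁ (inj₁ refl))

-- With the other two directions alternating, the count of empty lines applies to rows as well as
-- columns. The graph is `Δ`-regular, and each colour class is a permutation matrix.
fillLast : ∀ {a n Δ} (A : Hyper a n n) → Lines AltOrEmpty AltSeq AltSeq A → Δ + a ≡ n →
  Σ (Hyper n n n) λ B → A ⟶ B × Lines AltSeq AltSeq AltSeq B
fillLast {a} {Δ = Δ} A s refl = complete A s refl (λ j → ℕ.≤-reflexive (regular j)) single (λ j → inj₂ (regular j))
  where
  regular : ∀ j → count (λ k → null (nonzeros (λ i → A i j k))) ≡ Δ
  regular j = ℕ.+-cancelʳ-≡ a _ Δ
    (count-empty (λ i k → A i j k) (λ i → Lines.lines₃ s i j) (λ k → Lines.lines₁ s j k))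

-- Reaching a cube and assembling the chain of insertions

ReachesASHM : ∀ {a b c} → Hyper a b c → Set
ReachesASHM A = ∃[ n ] Σ (Hyper n n n) λ B → A ⟶ B × Lines AltSeq AltSeq AltSeq B

-- The final order is `a + b + c`. Zero planes first bring the symbol direction, of size `c`, to
-- that order; then `a + c` planes extend `b`, and `b + c` planes extend `a`.
completeToASHM : ∀ {a b c} (A : Hyper a b c) → Lines AltOrEmpty AltOrEmpty AltSeq A → ReachesASHM A
completeToASHM {a} {b} {c} A s
  with pad (a + b) (cyc (cyc A)) (inj₁ refl) (inj₁ refl) (Lines-cyc (Lines-cyc s))
... | A₁ , r₁ , s₁
  with fillMiddle {Δ = a + c} (cyc (cyc A₁)) (Lines-cyc (Lines-cyc s₁))
         (solve 3 (λ a b c → (a :+ c) :+ b := (a :+ b) :+ c) refl a b c) (ℕ.m≤m+n a c)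
  where open +-*-Solver
... | A₂ , r₂ , s₂
  with fillLast {Δ = b + c} (cyc (cyc A₂)) (Lines-cyc (Lines-cyc s₂))
         (solve 3 (λ a b c → (b :+ c) :+ a := (a :+ b) :+ c) refl a b c)
  where open +-*-Solver
... | A₃ , r₃ , s₃ =
  _ , A₃ , ⟶-trans (⟶-cyc (⟶-cyc (⟶-trans (⟶-cyc (⟶-cyc r₁)) r₂))) r₃ , s₃

ZeroPM⇒Lines : ∀ {a b c} (A : Hyper a b c) → IsZeroPMHyper A → Lines PM PM PM A
ZeroPM⇒Lines A z = lines
  (λ j k → All-nonzeros⁺ _ (λ i → sign (z i j k)))
  (λ k i → All-nonzeros⁺ _ (λ j → sign (z i j k)))
  (λ i j → All-nonzeros⁺ _ (λ k → sign (z i j k)))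
  where
  sign : ∀ {x} → ZeroPM x → x ≢ 0ℤ → IsSign x
  sign (inj₁ e)           x≢0 = contradiction e x≢0
  sign (inj₂ (inj₁ refl)) x≢0 = plus
  sign (inj₂ (inj₂ refl)) x≢0 = minus

-- Entries are `0ℤ` or a sign because each nonzero one occurs in an alternating list.
Lines⇒IsASHM : ∀ {n} {A B : Hyper n n n} → A ≋ B → Lines AltSeq AltSeq AltSeq B → IsASHM n A
Lines⇒IsASHM {A = A} {B} e (lines f g h) =
  (λ i j k → subst ZeroPM (sym (e i j k)) (zpm i j k)) ,
  (λ j k → subst AltSeq (nonzeros-cong (λ i → sym (e i j k))) (f j k)) ,
  (λ i k → subst AltSeq (nonzeros-cong (λ j → sym (e i j k))) (g k i)) ,
  (λ i j → subst AltSeq (nonzeros-cong (λ k → sym (e i j k))) (h i j))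
  where
  zpm : IsZeroPMHyper B
  zpm i j k with B i j k ℤ.≟ 0ℤ
  ... | yes z = inj₁ z
  ... | no nz with B i j k | All-nonzeros⁻ (λ i → B i j k) (Separated⇒PM (AltSeq⇒Separated (f j k))) i nz
  ...   | _ | plus  = inj₂ (inj₁ refl)
  ...   | _ | minus = inj₂ (inj₂ refl)

SubHyper⇒≤ : ∀ {a b c n} (A : Hyper a b c) (B : Hyper n n n) → SubHyper A B → a ⊔ b ⊔ c ≤ n
SubHyper⇒≤ A B (_ , _ , _ , f↑ , g↑ , h↑ , _) =
  ℕ.⊔-lub (ℕ.⊔-lub (StrictlyIncreasing⇒≤ f↑) (StrictlyIncreasing⇒≤ g↑)) (StrictlyIncreasing⇒≤ h↑)

ReachesASHM-⟶ : ∀ {a b c F G H} {A : Hyper a b c} →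
  (∃[ a′ ] ∃[ b′ ] ∃[ c′ ] Σ (Hyper a′ b′ c′) λ B → A ⟶ B × Lines F G H B) →
  (∀ {a b c} (B : Hyper a b c) → Lines F G H B → ReachesASHM B) → ReachesASHM A
ReachesASHM-⟶ (_ , _ , _ , B , r , s) k = extend (k B s)
  where
  extend : ReachesASHM B → ReachesASHM _
  extend (n , C , r′ , s′) = n , C , ⟶-trans r r′ , s′

reachASHM : ∀ {a b c} (A : Hyper a b c) → Lines PM PM PM A → ReachesASHM A
reachASHM A s =
  ReachesASHM-⟶ (separateAll A s) λ A₁ s₁ → ReachesASHM-⟶ (alternateAll A₁ s₁) completeToASHM

theorem4p16 : (m' n' k' : ℕ) (A' : Hyper m' n' k') → IsZeroPMHyper A' →
    ∃[ n ] (m' ⊔ n' ⊔ k' ≤ n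
    × Σ (Hyper n n n) λ A → IsASHM n A × SubHyper A' A
    × Star Step (mkHM m' n' k' A') (mkHM n n n A))
theorem4p16 m' n' k' A' zpm = conclude (reachASHM A' (ZeroPM⇒Lines A' zpm))
  where
  conclude : ReachesASHM A' →
    ∃[ n ] (m' ⊔ n' ⊔ k' ≤ n
    × Σ (Hyper n n n) λ A → IsASHM n A × SubHyper A' A
    × Star Step (mkHM m' n' k' A') (mkHM n n n A))
  -- The witness is `A`, the hypermatrix the steps literally produce; alternation carries over from
  -- the pointwise equal `B`.
  conclude (n , B , (A , A≋B , steps) , s) =
    n , SubHyper⇒≤ A' A (Star⇒SubHyper steps) , A , Lines⇒IsASHM A≋B s , Star⇒SubHyper steps , steps
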